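{- Let $m,n\in\mathbb{N}$, $0\le a\le n$, $0\le b\le m$ be integers. Then the dual of $R_{a,b}$ (with respect to $m,n$) is $\check{R}_{a,b}=V_{n-a,m-b}\cap R_{n,m}$. Consequently, for the family $\mathcal{F}=\{S_{a,0},S_{0,b}\}$ of double stars, $$\mathrm{ex}(m,n,\mathcal{F})=\min\{am,bn\}.$$
   Context: $\mathbb{Z}_+=\{0,1,2,\dots\}$, $\mathbb{N}=\{1,2,\dots\}$, $[0,c]=\{0,\dots,c\}$, $R_{a,b}=[0,a-1]\times[0,b-1]$ (empty if $a=0$ or $b=0$). A Young diagram is a downward-closed subset of $\mathbb{Z}_+^2$. For integers $a,b\ge0$, $V_{a,b}=\mathbb{Z}_+^2\setminus\{(x,y)\colon x\ge a,\ y\ge b\}$. A convex corner of a Young diagram $\mathcal{Y}$ is a maximal point of $\mathcal{Y}$ in the coordinatewise order; a concave corner is a minimal point of $\mathbb{Z}_+^2\setminus\mathcal{Y}$; $\mathcal{I}_{\mathcal{Y}}$ is the set of concave corners. For a Young diagram $\mathcal{Y}\subseteq R_{n,m}$, its dual is the unique Young diagram $\check{\mathcal{Y}}\subseteq R_{n,m}$ whose set of convex corners is $\{(n-a-1,m-b-1)\colon (a,b)\in\mathcal{I}_{\mathcal{Y}},\ 0\le a\le n-1,\ 0\le b\le m-1\}$. For integers $p,q\ge0$, the double star $S_{p,q}$ is obtained from disjoint $K_{1,p}$ and $K_{1,q}$ by adding an edge between the center $u$ of $K_{1,p}$ and the center $v$ of $K_{1,q}$ (so $u$ has degree $p+1$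 and $v$ degree $q+1$); it is equipped with the bipartition $(X_{p,q},Y_{p,q})$ with $u\in X_{p,q}$, $v\in Y_{p,q}$. For a family $\mathcal{F}$ of double stars, $\mathrm{ex}(m,n,\mathcal{F})$ is the maximum number of edges in a bipartite graph with bipartition $(X,Y)$, $|X|=m$, $|Y|=n$, that contains no $S_{p,q}\in\mathcal{F}$ as a (not necessarily induced) subgraph respecting the bipartitions (with $X_{p,q}$ inside $X$ and $Y_{p,q}$ inside $Y$). -}

module Defs where

open import Data.Bool using (Bool; true; false; if_then_else_)
open import Data.Fin using (Fin; zero; suc)
open import Data.Nat using (ℕ; zero; suc; _∸_; _≤_; _<_)
open import Data.Nat.Properties using (+-0-commutativeMonoid)
open import Data.Product using (_×_; _,_; ∃-syntax)
open import Data.Product.Relation.Binary.Pointwise.NonDependent using (Pointwise)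
open import Function.Definitions using (Injective)
open import Level using (0ℓ)
open import Relation.Binary.Core using (Rel)
open import Relation.Binary.PropositionalEquality using (_≡_)
open import Relation.Nullary using (¬_)
open import Relation.Unary using (Pred; _∈_; _⊆_; _≐_; ∁)

Point : Set
Point = ℕ × ℕ

_⊑_ : Rel Point 0ℓ
_⊑_ = Pointwise _≤_ _≤_

PointSet : Set₁
PointSet = Pred Point 0ℓ

IsYoungDiagram : PointSet → Set
IsYoungDiagram Y = ∀ {p q} → p ⊑ q → q ∈ Y → p ∈ Y

IsMaximal : PointSet → PointSet
IsMaximal S p = p ∈ S × (∀ {q} → q ∈ S → p ⊑ q → q ≡ p)

IsMinimal : PointSet → PointSet
IsMinimal S p = p ∈ S × (∀ {q} → q ∈ S → q ⊑ p → q ≡ p)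

ConvexCorners : PointSet → PointSet
ConvexCorners Y = IsMaximal Y

ConcaveCorners : PointSet → PointSet
ConcaveCorners Y = IsMinimal (∁ Y)

-- The interval [0, a - 1] is {x | x < a}, which is empty for a = 0.
R : ℕ → ℕ → PointSet
R a b (x , y) = x < a × y < b

V : ℕ → ℕ → PointSet
V a b = ∁ (λ (x , y) → a ≤ x × b ≤ y)

-- Both truncated subtractions are exact because a < n and b < m.
ReflectedCorners : ℕ → ℕ → PointSet → PointSet
ReflectedCorners n m Y p =
  ∃[ a ] ∃[ b ] ((a , b) ∈ ConcaveCorners Y × a < n × b < m
                 × p ≡ (n ∸ a ∸ 1 , m ∸ b ∸ 1))

record HasDualCorners (n m : ℕ) (Y D : PointSet) : Set where
  field
    young   : IsYoungDiagram D
    inside  : D ⊆ R n m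
    corners : ConvexCorners D ≐ ReflectedCorners n m Y

-- D is the dual of Y inside R n m.  Duality is a relation on predicates, so
-- the definite description "the unique Young diagram such that" is spelled
-- out as existence together with uniqueness up to extensional equality.
record IsDual (n m : ℕ) (Y D : PointSet) : Set₁ where
  field
    source-young  : IsYoungDiagram Y
    source-inside : Y ⊆ R n m
    dual          : HasDualCorners n m Y D
    unique        : ∀ (E : PointSet) → HasDualCorners n m Y E → E ≐ D

-- A bipartite graph with parts X = Fin m and Y = Fin n, given by adjacency.
BipartiteGraph : ℕ → ℕ → Set
BipartiteGraph m n = Fin m → Fin n → Bool

edgeCount : ∀ {m n} → BipartiteGraph m n → ℕ
edgeCount {m} {n} G = ∑[ x < m ] ∑[ y < n ] (if G x y then 1 else 0)
  where open import Algebra.Properties.CommutativeMonoid.Sum +-0-commutativeMonoid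

-- The part X consists of u = zero and the q leaves of v; the part Y consists
-- of v = zero and the p leaves of u.
doubleStar : ∀ p q → BipartiteGraph (suc q) (suc p)
doubleStar p q zero    _       = true
doubleStar p q (suc _) zero    = true
doubleStar p q (suc _) (suc _) = false

-- H is a (not necessarily induced) subgraph of G, respecting the bipartitions.
_⊑ᴳ_ : ∀ {k l m n} → BipartiteGraph k l → BipartiteGraph m n → Set
_⊑ᴳ_ {k} {l} {m} {n} H G =
  ∃[ f ] ∃[ g ] (Injective {A = Fin k} {B = Fin m} _≡_ _≡_ f
               × Injective {A = Fin l} {B = Fin n} _≡_ _≡_ g
               × (∀ x y → H x y ≡ true → G (f x) (g y) ≡ true))

-- A family of double stars is the set of its parameters (p , q).
Family : Set₁
Family = Pred (ℕ × ℕ) 0ℓ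

IsFree : ∀ {m n} → Family → BipartiteGraph m n → Set
IsFree 𝓕 G = ∀ p q → (p , q) ∈ 𝓕 → ¬ (doubleStar p q ⊑ᴳ G)

-- ex(m, n, 𝓕) = k, for the maximum number k of edges.
IsEx : ℕ → ℕ → Family → ℕ → Set
IsEx m n 𝓕 k =
    (∃[ G ] (IsFree {m} {n} 𝓕 G × edgeCount G ≡ k))
  × (∀ (G : BipartiteGraph m n) → IsFree 𝓕 G → edgeCount G ≤ k)

-- The dual of any decidable Young diagram Y in the box is its complement in the
-- box rotated by 180°, because the rotation reverses the order and so exchanges
-- minimal points of the complement with maximal points of the dual.
--
-- Excluding S_{a,0} and S_{0,b} bounds the degrees in X by a and those in Y by b,
-- and counting edges from either side bounds their number by both am and bn.
-- If am ≤ bn, join x and y when ⌊(xa + y)/n⌋ < ⌊((x + 1)a + y)/n⌋.  As a ≤ n,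
-- consecutive floors differ by at most one.  Hermite's identity
-- ∑_{y < n} ⌊(N + y)/n⌋ = N gives every x degree a, and telescoping gives y the
-- degree ⌊(ma + y)/n⌋ ≤ ⌊(bn + y)/n⌋ = b.  The case bn ≤ am is its transpose.
module Submission where

open import Data.Bool using (Bool; true; false; if_then_else_)
open import Data.Fin using (Fin; zero; suc; toℕ; splitAt; _↑ˡ_; _↑ʳ_)
open import Data.Fin.Properties
  using (toℕ<n; splitAt-↑ˡ; splitAt-↑ʳ; ↑ʳ-injective; injective⇒≤; suc-injective)
open import Data.Nat using (ℕ; zero; suc; _+_; _*_; _∸_; _/_; _≤_; _<_; _⊓_; _<?_; _<ᵇ_; z≤n; s≤s; NonZero)
open import Data.Nat.DivMod
open import Data.Nat.Divisibility using (divides-refl; ∣-refl)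
open import Data.Nat.Properties hiding (suc-injective)
open import Data.Product using (_×_; _,_; proj₁; proj₂; uncurry; ∃-syntax)
open import Data.Sum using (inj₁; inj₂)
open import Function using (_∘_; flip)
open import Function.Definitions using (Injective)
open import Relation.Binary.PropositionalEquality
open import Relation.Nullary using (Dec; yes; no; ofʸ; ofⁿ; ¬?; _×-dec_; contradiction)
open import Relation.Nullary.Decidable using (¬¬-excluded-middle; decidable-stable)
open import Relation.Unary using (Decidable; _∈_; _∉_; _⊆_; _≐_; _∩_; _∪_; ｛_｝)
open import Relation.Unary.Properties using (≐-sym; ≐-trans)
open import Defs

open import Algebra.Properties.CommutativeMonoid.Sum +-0-commutativeMonoid
  using (sum-syntax; sum-cong-≗; ∑-distrib-+; ∑-comm)

open ≤-Reasoning

private variable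
  a b k m n : ℕ

-- Young diagrams and duality

rotate : ℕ → ℕ → Point → Point
rotate n m (x , y) = n ∸ x ∸ 1 , m ∸ y ∸ 1

flip-< : ∀ {x} → x < n → n ∸ x ∸ 1 < n
flip-< {suc n} {x} _ = s≤s (begin
  suc n ∸ x ∸ 1 ≡⟨ pred[m∸n]≡m∸[1+n] (suc n) x ⟩
  n ∸ x         ≤⟨ m∸n≤m n x ⟩
  n             ∎)

flip-involutive : ∀ {x} → x < n → n ∸ (n ∸ x ∸ 1) ∸ 1 ≡ x
flip-involutive {suc n} {x} (s≤s x≤n) = begin-equality
  suc n ∸ (suc n ∸ x ∸ 1) ∸ 1 ≡⟨ cong (λ z → suc n ∸ z ∸ 1) (pred[m∸n]≡m∸[1+n] (suc n) x) ⟩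
  suc n ∸ (n ∸ x) ∸ 1         ≡⟨ pred[m∸n]≡m∸[1+n] (suc n) (n ∸ x) ⟩
  n ∸ (n ∸ x)                 ≡⟨ m∸[m∸n]≡n x≤n ⟩
  x                           ∎

flip-anti : ∀ n {x y} → x ≤ y → n ∸ y ∸ 1 ≤ n ∸ x ∸ 1
flip-anti n x≤y = ∸-monoˡ-≤ 1 (∸-monoʳ-≤ n x≤y)

rotate-R : ∀ {p} → p ∈ R n m → rotate n m p ∈ R n m
rotate-R (x<n , y<m) = flip-< x<n , flip-< y<m

rotate-involutive : ∀ {p} → p ∈ R n m → rotate n m (rotate n m p) ≡ p
rotate-involutive (x<n , y<m) = cong₂ _,_ (flip-involutive x<n) (flip-involutive y<m)

rotate-anti : ∀ n m {p q} → p ⊑ q → rotate n m q ⊑ rotate n m p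
rotate-anti n m (x≤ , y≤) = flip-anti n x≤ , flip-anti m y≤

R-young : ∀ n m → IsYoungDiagram (R n m)
R-young _ _ (x≤ , y≤) (<n , <m) = ≤-<-trans x≤ <n , ≤-<-trans y≤ <m

R-mono : ∀ {n′ m′} → n ≤ n′ → m ≤ m′ → R n m ⊆ R n′ m′
R-mono n≤ m≤ (x< , y<) = <-≤-trans x< n≤ , <-≤-trans y< m≤

R? : ∀ n m → Decidable (R n m)
R? n m (x , y) = x <? n ×-dec y <? m

-- In continuation-passing style the search for a maximal point covers both a
-- decidable S, with arbitrary Q, and an undecidable one, with Q = ⊥.
maximal-above : ∀ {S} → IsYoungDiagram S → S ⊆ R n m →
  {Q : Set} → (∀ p → (Dec (p ∈ S) → Q) → Q) →
  ∀ {p} → p ∈ S → (∀ {q} → q ∈ ConvexCorners S → p ⊑ q → Q) → Q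
maximal-above {n} {m} {S} young inside {Q} decide {p} p∈S return =
  climb (n + m) p (m≤m+n _ _) p∈S return
  where
  climb : ∀ fuel p → n + m ≤ fuel + (proj₁ p + proj₂ p) → p ∈ S →
    (∀ {q} → q ∈ ConvexCorners S → p ⊑ q → Q) → Q
  -- Each move raises the coordinate sum by one, and in the box that sum stays below `n + m`, so the
  -- fuel cannot run out.
  climb zero p bound p∈S _ =
    contradiction bound (<⇒≱ (uncurry +-mono-< (inside p∈S)))
  climb (suc fuel) p@(x , y) bound p∈S return =
    decide (suc x , y) λ where
      (yes right∈S) → climb fuel (suc x , y) (≤-trans bound (≤-reflexive (sym (+-suc fuel _)))) right∈S
        λ corner (x< , y≤) → return corner (<⇒≤ x< , y≤)
      (no right∉S) → decide (x , suc y) λ where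
        (yes up∈S) → climb fuel (x , suc y)
          (≤-trans bound (≤-reflexive (trans (sym (+-suc fuel _)) (cong (fuel +_) (sym (+-suc x y))))))
          up∈S λ corner (x≤ , y<) → return corner (x≤ , <⇒≤ y<)
        -- A point of `S` strictly above `p` would dominate one of the two unit neighbours, which
        -- downward closure would then put in `S`.
        (no up∉S) → return
          (p∈S , λ q∈S (x≤ , y≤) → cong₂ _,_
            (≤-antisym (≮⇒≥ λ x< → right∉S (young (x< , y≤) q∈S)) x≤)
            (≤-antisym (≮⇒≥ λ y< → up∉S (young (x≤ , y<) q∈S)) y≤))
          (≤-refl , ≤-refl)

-- The image of the complement under the rotation, which is an involution on the box; testing the
-- rotated point keeps the set decidable when `Y` is.
RotatedComplement : ℕ → ℕ → PointSet → PointSet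
RotatedComplement n m Y p = p ∈ R n m × rotate n m p ∉ Y

rotatedComplement-dualCorners : ∀ {Y} → IsYoungDiagram Y →
  HasDualCorners n m Y (RotatedComplement n m Y)
rotatedComplement-dualCorners {n} {m} {Y} Y-young = record
  { young   = λ p⊑q (q∈R , rq∉Y) →
      R-young n m p⊑q q∈R , λ rp∈Y → rq∉Y (Y-young (rotate-anti n m p⊑q) rp∈Y)
  ; inside  = proj₁
  ; corners = to , from
  }
  where
  D : PointSet
  D = RotatedComplement n m Y

  rotate-∈D : ∀ {q} → q ∈ R n m → q ∉ Y → rotate n m q ∈ D
  rotate-∈D q∈R q∉Y = rotate-R q∈R , q∉Y ∘ subst Y (rotate-involutive q∈R)

  to : ConvexCorners D ⊆ ReflectedCorners n m Y
  to {p} ((p∈R , rp∉Y) , maximal) =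
    _ , _ , (rp∉Y , minimal) , proj₁ (rotate-R p∈R) , proj₂ (rotate-R p∈R)
    , sym (rotate-involutive p∈R)
    where
    -- The box is a Young diagram, so a competitor `q` lies in it and its rotation is a point of `D`
    -- above `p`.
    minimal : ∀ {q} → q ∉ Y → q ⊑ rotate n m p → q ≡ rotate n m p
    minimal q∉Y q⊑rp = trans (sym (rotate-involutive q∈R)) (cong (rotate n m)
      (maximal (rotate-∈D q∈R q∉Y)
        (subst (_⊑ _) (rotate-involutive p∈R) (rotate-anti n m q⊑rp))))
      where q∈R = R-young n m q⊑rp (rotate-R p∈R)

  from : ReflectedCorners n m Y ⊆ ConvexCorners D
  from (x , y , (c∉Y , minimal) , x<n , y<m , refl) =
    rotate-∈D (x<n , y<m) c∉Y ,
    λ {q} (q∈R , rq∉Y) rc⊑q → trans (sym (rotate-involutive q∈R)) (cong (rotate n m)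
      (minimal rq∉Y (subst (rotate n m q ⊑_) (rotate-involutive (x<n , y<m)) (rotate-anti n m rc⊑q))))

maximal-≐ : ∀ {S T} → S ≐ T → IsMaximal S ⊆ IsMaximal T
maximal-≐ (S⊆T , T⊆S) (p∈S , maximal) = S⊆T p∈S , maximal ∘ T⊆S

dualCorners-≐ : ∀ {Y D E} → D ≐ E → HasDualCorners n m Y D → HasDualCorners n m Y E
dualCorners-≐ D≐E@(D⊆E , E⊆D) dual = record
  { young   = λ p⊑q → D⊆E ∘ young p⊑q ∘ E⊆D
  ; inside  = inside ∘ E⊆D
  ; corners = ≐-trans (maximal-≐ (≐-sym D≐E) , maximal-≐ D≐E) corners
  }
  where open HasDualCorners dual

-- A bounded Young diagram is the down-set of its convex corners, which `D` and `E` share.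
dualCorners-unique : ∀ {Y D E} → Decidable D →
  HasDualCorners n m Y D → HasDualCorners n m Y E → E ≐ D
dualCorners-unique D? dual-D dual-E =
  -- `E` may be undecidable: a corner above `p` is found only under double negation, which the
  -- decidability of `D` removes.
  (λ {p} p∈E → decidable-stable (D? p) λ p∉D →
    maximal-above E.young E.inside (λ _ → ¬¬-excluded-middle) p∈E
      λ q∈ p⊑q → p∉D (D.young p⊑q (proj₁ (proj₂ D.corners (proj₁ E.corners q∈)))))
  , λ p∈D →
    maximal-above D.young D.inside (λ q k → k (D? q)) p∈D
      λ q∈ p⊑q → E.young p⊑q (proj₁ (proj₂ E.corners (proj₁ D.corners q∈)))
  where
  module D = HasDualCorners dual-D
  module E = HasDualCorners dual-E

rotatedComplement-isDual : ∀ {Y D} → IsYoungDiagram Y → Y ⊆ R n m → Decidable Y →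
  RotatedComplement n m Y ≐ D → IsDual n m Y D
rotatedComplement-isDual {n} {m} Y-young Y⊆R Y? C≐D = record
  { source-young  = Y-young
  ; source-inside = Y⊆R
  ; dual          = dualCorners-≐ C≐D dual-C
  ; unique        = λ _ dual-E → ≐-trans (dualCorners-unique C? dual-C dual-E) C≐D
  }
  where
  dual-C = rotatedComplement-dualCorners Y-young
  C? = λ p → R? n m p ×-dec ¬? (Y? (rotate n m p))

-- This and the converse below pass through `n ≤ x + a`; they match the rotated rectangle with the
-- quadrant excluded from `V`.
flip<⇒∸≤ : ∀ {x} → x < n → n ∸ x ∸ 1 < a → n ∸ a ≤ x
flip<⇒∸≤ {n} {a} {x} x<n flip<a = m≤n+o⇒m∸n≤o n a (begin
  n                   ≤⟨ m≤n+m∸n n x ⟩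
  x + (n ∸ x)         ≤⟨ +-monoʳ-≤ x (m≤n+m∸n (n ∸ x) 1) ⟩
  x + suc (n ∸ x ∸ 1) ≤⟨ +-monoʳ-≤ x flip<a ⟩
  x + a               ≡⟨ +-comm x a ⟩
  a + x               ∎)

∸≤⇒flip< : ∀ {x} → x < n → n ∸ a ≤ x → n ∸ x ∸ 1 < a
∸≤⇒flip< {n} {a} {x} x<n n∸a≤x = begin-strict
  -- `x < n` makes `n ∸ x` positive, so subtracting 1 is strict.
  n ∸ x ∸ 1 <⟨ ∸-monoʳ-< {o = 0} (s≤s z≤n) (m<n⇒0<n∸m x<n) ⟩
  n ∸ x     ≤⟨ m≤n+o⇒m∸n≤o n x n≤x+a ⟩
  a         ∎
  where
  n≤x+a : n ≤ x + a
  n≤x+a = begin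
    n           ≤⟨ m≤n+m∸n n a ⟩
    a + (n ∸ a) ≤⟨ +-monoʳ-≤ a n∸a≤x ⟩
    a + x       ≡⟨ +-comm a x ⟩
    x + a       ∎

rotatedComplement-R : RotatedComplement n m (R a b) ≐ V (n ∸ a) (m ∸ b) ∩ R n m
rotatedComplement-R =
    (λ ((x<n , y<m) , rp∉R) →
      (λ (≤x , ≤y) → rp∉R (∸≤⇒flip< x<n ≤x , ∸≤⇒flip< y<m ≤y)) , x<n , y<m)
  , λ (p∈V , x<n , y<m) → (x<n , y<m) ,
      λ (<a , <b) → p∈V (flip<⇒∸≤ x<n <a , flip<⇒∸≤ y<m <b)

-- Counting

count : (Fin n → Bool) → ℕ
count p = ∑[ i < _ ] (if p i then 1 else 0)

∑-const : ∀ n c → ∑[ i < n ] c ≡ c * n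
∑-const zero    c = sym (*-zeroʳ c)
∑-const (suc n) c = trans (cong (c +_) (∑-const n c)) (sym (*-suc c n))

∑-≤ : ∀ {c} (f : Fin n → ℕ) → (∀ i → f i ≤ c) → ∑[ i < n ] f i ≤ c * n
∑-≤ {zero}      f f≤c = z≤n
∑-≤ {suc n} {c} f f≤c = begin
  f zero + ∑[ i < n ] f (suc i) ≤⟨ +-mono-≤ (f≤c zero) (∑-≤ (f ∘ suc) (f≤c ∘ suc)) ⟩
  c + c * n                     ≡⟨ *-suc c n ⟨
  c * suc n                     ∎

-- `Fin (count p)` is a concatenation of blocks, with one element for each `true` and none for each
-- `false`; an index goes to its own block, so distinct indices stay apart.
rank : (p : Fin n → Bool) (i : Fin n) → p i ≡ true → Fin (count p)
rank p zero    pi = bit (p zero) pi ↑ˡ _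
  where
  -- Generalising `p zero` to `b` lets the equation reduce the block to `Fin 1`.
  bit : ∀ b → b ≡ true → Fin (if b then 1 else 0)
  bit true refl = zero
rank p (suc i) pi = _ ↑ʳ rank (p ∘ suc) i pi

↑ˡ≢↑ʳ : ∀ {i : Fin m} {j : Fin n} → i ↑ˡ n ≢ m ↑ʳ j
↑ˡ≢↑ʳ {m} {n} {i} {j} eq
  with () ← trans (sym (splitAt-↑ˡ m i n)) (trans (cong (splitAt m) eq) (splitAt-↑ʳ m n j))

rank-injective : (p : Fin n → Bool) {i j : Fin n} (pi : p i ≡ true) (pj : p j ≡ true) →
  rank p i pi ≡ rank p j pj → i ≡ j
rank-injective p {zero}  {zero}  pi pj eq = refl
rank-injective p {zero}  {suc j} pi pj eq = contradiction eq ↑ˡ≢↑ʳ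
rank-injective p {suc i} {zero}  pi pj eq = contradiction (sym eq) ↑ˡ≢↑ʳ
rank-injective p {suc i} {suc j} pi pj eq =
  cong suc (rank-injective (p ∘ suc) pi pj (↑ʳ-injective _ _ _ eq))

injection⇒≤count : (p : Fin n → Bool) (f : Fin k → Fin n) → Injective _≡_ _≡_ f →
  (∀ i → p (f i) ≡ true) → k ≤ count p
injection⇒≤count p f f-inj pf =
  injective⇒≤ {f = λ i → rank p (f i) (pf i)} (f-inj ∘ rank-injective p (pf _) (pf _))

-- Greedy choice of the first `k` indices where `p` holds; they become the leaves of a forbidden
-- star.
≤count⇒injection : (p : Fin n → Bool) → k ≤ count p →
  ∃[ f ] (Injective {A = Fin k} _≡_ _≡_ f × (∀ i → p (f i) ≡ true))
≤count⇒injection {k = zero} p k≤ = (λ ()) , (λ { {()} }) , λ ()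
≤count⇒injection {suc n} {suc k} p k≤ with p zero in p0
... | false =
  let f , f-inj , pf = ≤count⇒injection (p ∘ suc) k≤
  in suc ∘ f , f-inj ∘ suc-injective , pf
... | true =
  let f , f-inj , pf = ≤count⇒injection (p ∘ suc) (≤-pred k≤)
  in  (λ { zero → zero ; (suc i) → suc (f i) })
    , (λ { {zero} {zero} _ → refl
         ; {suc i} {suc j} eq → cong suc (f-inj (suc-injective eq)) })
    , λ { zero → p0 ; (suc i) → pf i }

-- Degrees in free graphs

DegreesAtMost : ℕ → ℕ → BipartiteGraph m n → Set
DegreesAtMost a b G = (∀ x → count (G x) ≤ a) × (∀ y → count (flip G y) ≤ b)

Stars : ℕ → ℕ → Family
Stars a b = ｛ (a , 0) ｝ ∪ ｛ (0 , b) ｝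

constant-injective : ∀ {A : Set} {x : A} → Injective {A = Fin 1} _≡_ _≡_ (λ _ → x)
constant-injective {_} {_} {zero} {zero} _ = refl

-- For `q = 0` the vertex v is one more leaf of u, so S_{a,0} is a star with `a + 1` leaves, and a
-- degree above `a` yields a copy. S_{0,b} is symmetric.
free⇒degrees : (G : BipartiteGraph m n) → IsFree (Stars a b) G → DegreesAtMost a b G
free⇒degrees {a = a} {b} G free =
    (λ x → ≮⇒≥ λ a< →
      let g , g-inj , Gg = ≤count⇒injection (G x) a<
      in free a 0 (inj₁ refl)
           ((λ _ → x) , g , constant-injective , g-inj , λ _ j _ → Gg j))
  , (λ y → ≮⇒≥ λ b< →
      let f , f-inj , Gf = ≤count⇒injection (flip G y) b<
      in free 0 b (inj₂ refl)
           (f , (λ _ → y) , f-inj , constant-injective , λ i _ _ → Gf i))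

degrees⇒free : (G : BipartiteGraph m n) → DegreesAtMost a b G → IsFree (Stars a b) G
degrees⇒free G (row≤ , col≤) p q (inj₁ refl) (f , g , f-inj , g-inj , edge) =
  -- `f zero` is the image of the centre u, and `g` lists `a + 1` neighbours of it.
  <⇒≱ (injection⇒≤count (G (f zero)) g g-inj λ j → edge zero j refl) (row≤ (f zero))
degrees⇒free G (row≤ , col≤) p q (inj₂ refl) (f , g , f-inj , g-inj , edge) =
  <⇒≱ (injection⇒≤count (flip G (g zero)) f f-inj λ i → edge i zero (first-column i)) (col≤ (g zero))
  where
  first-column : ∀ i → doubleStar 0 q i zero ≡ true
  first-column zero    = refl
  first-column (suc _) = refl

edgeCount-transpose : (G : BipartiteGraph m n) → edgeCount G ≡ edgeCount (flip G)
edgeCount-transpose G = ∑-comm λ x y → if G x y then 1 else 0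

degrees⇒edgeCount≤ : (G : BipartiteGraph m n) → DegreesAtMost a b G →
  edgeCount G ≤ (a * m) ⊓ (b * n)
degrees⇒edgeCount≤ G (row≤ , col≤) = ⊓-glb (∑-≤ _ row≤)
  (≤-trans (≤-reflexive (edgeCount-transpose G)) (∑-≤ _ col≤))

-- The extremal graph

-- Both sides sum `f` over 0, ..., k; one splits off the first term, the other the last.
∑-shift : ∀ k (f : ℕ → ℕ) →
  f 0 + ∑[ i < k ] f (suc (toℕ i)) ≡ ∑[ i < k ] f (toℕ i) + f k
∑-shift zero    f = +-identityʳ (f 0)
∑-shift (suc k) f = trans (cong (f 0 +_) (∑-shift k (f ∘ suc))) (sym (+-assoc (f 0) _ _))

∑-telescope : ∀ k (f d : ℕ → ℕ) → (∀ i → f i + d i ≡ f (suc i)) →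
  f 0 + ∑[ i < k ] d (toℕ i) ≡ f k
∑-telescope zero    f d step = +-identityʳ (f 0)
∑-telescope (suc k) f d step = begin-equality
  f 0 + (d 0 + ∑[ i < k ] d (suc (toℕ i))) ≡⟨ +-assoc (f 0) (d 0) _ ⟨
  f 0 + d 0 + ∑[ i < k ] d (suc (toℕ i))   ≡⟨ cong (_+ _) (step 0) ⟩
  f 1 + ∑[ i < k ] d (suc (toℕ i))         ≡⟨ ∑-telescope k (f ∘ suc) (d ∘ suc) (step ∘ suc) ⟩
  f (suc k)                                ∎

[m+n]/n≡1+m/n : ∀ m n .{{_ : NonZero n}} → (m + n) / n ≡ suc (m / n)
[m+n]/n≡1+m/n m n = begin-equality
  (m + n) / n    ≡⟨ +-distrib-/-∣ʳ m ∣-refl ⟩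
  m / n + n / n  ≡⟨ cong (m / n +_) (n/n≡1 n) ⟩
  m / n + 1      ≡⟨ +-comm (m / n) 1 ⟩
  suc (m / n)    ∎

-- Raising `N` by one slides the window of numerators: the term `N / n` drops out and `(N + n) / n`,
-- larger by one, enters.
hermite : ∀ n .{{_ : NonZero n}} N → ∑[ i < n ] ((N + toℕ i) / n) ≡ N
hermite n zero = begin-equality
  ∑[ i < n ] (toℕ i / n) ≡⟨ sum-cong-≗ (λ i → m<n⇒m/n≡0 (toℕ<n i)) ⟩
  ∑[ i < n ] 0           ≡⟨ ∑-const n 0 ⟩
  0                      ∎
hermite n (suc N) = +-cancelˡ-≡ (N / n) _ _ (begin-equality
  N / n + ∑[ i < n ] ((suc N + toℕ i) / n)
    ≡⟨ cong₂ _+_ (cong (_/ n) (sym (+-identityʳ N)))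
         (sum-cong-≗ {n} λ i → cong (_/ n) (sym (+-suc N (toℕ i)))) ⟩
  (N + 0) / n + ∑[ i < n ] ((N + suc (toℕ i)) / n)
    ≡⟨ ∑-shift n (λ i → (N + i) / n) ⟩
  ∑[ i < n ] ((N + toℕ i) / n) + (N + n) / n
    ≡⟨ cong₂ _+_ (hermite n N) ([m+n]/n≡1+m/n N n) ⟩
  N + suc (N / n)
    ≡⟨ +-comm N _ ⟩
  suc (N / n) + N
    ≡⟨ +-suc (N / n) N ⟨
  N / n + suc N ∎)

indicator-step : ∀ p q → p ≤ q → q ≤ suc p →
  p + (if p <ᵇ q then 1 else 0) ≡ q
indicator-step p q p≤q q≤1+p with p <ᵇ q | <ᵇ-reflects-< p q
... | true  | ofʸ p<q = trans (+-comm p 1) (≤-antisym p<q q≤1+p)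
... | false | ofⁿ p≮q = trans (+-identityʳ p) (≤-antisym p≤q (≮⇒≥ p≮q))

module _ (a m n : ℕ) .{{_ : NonZero n}} where

  -- For `a ≤ n` and `y < n` this counts the neighbours of `y` among the first `x` rows. Taking `y`
  -- first makes a column a function to telescope.
  level : ℕ → ℕ → ℕ
  level y x = (x * a + y) / n

  -- True when a multiple of `n` lies among `x * a + y + 1`, ..., `x * a + y + a`. For `a ≤ n`,
  -- successive rows thus take the columns cyclically, `a` at a time.
  edge : ℕ → ℕ → Bool
  edge x y = level y x <ᵇ level y (suc x)

  balancedGraph : BipartiteGraph m n
  balancedGraph x y = edge (toℕ x) (toℕ y)

  module _ (a≤n : a ≤ n) where

    level-step : ∀ y x → level y x + (if edge x y then 1 else 0) ≡ level y (suc x)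
    level-step y x = indicator-step _ _
      (/-monoˡ-≤ n (+-monoˡ-≤ y (m≤n+m (x * a) a)))
      (begin
        (a + x * a + y) / n     ≡⟨ cong (_/ n) (+-assoc a (x * a) y) ⟩
        (a + (x * a + y)) / n   ≤⟨ /-monoˡ-≤ n (+-monoˡ-≤ (x * a + y) a≤n) ⟩
        (n + (x * a + y)) / n   ≡⟨ cong (_/ n) (+-comm n _) ⟩
        (x * a + y + n) / n     ≡⟨ [m+n]/n≡1+m/n (x * a + y) n ⟩
        suc ((x * a + y) / n)   ∎)

    balanced-row : ∀ x → count (balancedGraph x) ≡ a
    balanced-row i = +-cancelˡ-≡ (x * a) _ _ (begin-equality
      x * a + count (balancedGraph i)
        ≡⟨ cong (_+ count (balancedGraph i)) (hermite n (x * a)) ⟨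
      ∑[ y < n ] level (toℕ y) x + count (balancedGraph i)
        ≡⟨ ∑-distrib-+ {n} (λ y → level (toℕ y) x) _ ⟨
      ∑[ y < n ] (level (toℕ y) x + (if balancedGraph i y then 1 else 0))
        ≡⟨ sum-cong-≗ {n} (λ y → level-step (toℕ y) x) ⟩
      ∑[ y < n ] level (toℕ y) (suc x)
        ≡⟨ hermite n (suc x * a) ⟩
      a + x * a
        ≡⟨ +-comm a _ ⟩
      x * a + a ∎)
      where x = toℕ i

    balanced-column : a * m ≤ b * n → ∀ y → count (flip balancedGraph y) ≤ b
    balanced-column {b} am≤bn j = begin
      count (flip balancedGraph j)
        -- The initial level may be added, as only an upper bound is claimed.
        ≤⟨ m≤n+m _ (level y 0) ⟩
      level y 0 + count (flip balancedGraph j)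
        ≡⟨ ∑-telescope m (level y) _ (level-step y) ⟩
      (m * a + y) / n
        ≤⟨ /-monoˡ-≤ n (+-monoˡ-≤ y (≤-trans (≤-reflexive (*-comm m a)) am≤bn)) ⟩
      (b * n + y) / n
        ≡⟨ +-distrib-/-∣ˡ y (divides-refl b) ⟩
      b * n / n + y / n
        ≡⟨ cong₂ _+_ (m*n/n≡m b n) (m<n⇒m/n≡0 (toℕ<n j)) ⟩
      b + 0
        ≡⟨ +-identityʳ b ⟩
      b ∎
      where y = toℕ j

    balanced-edgeCount : edgeCount balancedGraph ≡ a * m
    balanced-edgeCount = trans (sum-cong-≗ balanced-row) (∑-const m a)

extremal : ∀ m n .{{_ : NonZero m}} .{{_ : NonZero n}} → a ≤ n → b ≤ m →
  ∃[ G ] (DegreesAtMost {m} {n} a b G × edgeCount G ≡ (a * m) ⊓ (b * n))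
extremal {a} {b} m n a≤n b≤m with ≤-total (a * m) (b * n)
... | inj₁ am≤bn = balancedGraph a m n
  , ( (λ x → ≤-reflexive (balanced-row a m n a≤n x)) , balanced-column a m n a≤n am≤bn)
  , trans (balanced-edgeCount a m n a≤n) (sym (m≤n⇒m⊓n≡m am≤bn))
-- With the roles of X and Y exchanged, the exact degrees are those in Y.
... | inj₂ bn≤am = flip (balancedGraph b n m)
  , (balanced-column b n m b≤m bn≤am , λ y → ≤-reflexive (balanced-row b n m b≤m y))
  , trans (edgeCount-transpose (flip (balancedGraph b n m)))
      (trans (balanced-edgeCount b n m b≤m) (sym (m≥n⇒m⊓n≡n bn≤am)))

stars-ex : ∀ m n .{{_ : NonZero m}} .{{_ : NonZero n}} → a ≤ n → b ≤ m →
  IsEx m n (Stars a b) ((a * m) ⊓ (b * n))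
stars-ex m n a≤n b≤m =
  let G , degrees , edges = extremal m n a≤n b≤m
  in  (G , degrees⇒free G degrees , edges)
    , λ H free → degrees⇒edgeCount≤ H (free⇒degrees H free)

corollary3p2 : ∀ (m n a b : ℕ) → 1 ≤ m → 1 ≤ n → a ≤ n → b ≤ m →
    IsDual n m (R a b) (V (n ∸ a) (m ∸ b) ∩ R n m)
    × IsEx m n (｛ (a , 0) ｝ ∪ ｛ (0 , b) ｝) ((a * m) ⊓ (b * n))
-- The patterns `suc _` supply the `NonZero` instances for dividing by `m` and `n`.
corollary3p2 m@(suc _) n@(suc _) a b _ _ a≤n b≤m =
    rotatedComplement-isDual (R-young a b) (R-mono a≤n b≤m) (R? a b) rotatedComplement-R
  , stars-ex m n a≤n b≤m
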